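{- Let $\mathsf{t}$ be a term of the Linear Time $\nu$-calculus. Then its semantics $[\![\mathsf{t}]\!]\subseteq\mathcal{E}^\omega$ is a safety property.
   Context: Let $\mathcal{E}$ be a set of events, $AP$ a countable set of atomic propositions and $\langle\!\langle -\rangle\!\rangle:AP\to\wp(\mathcal{E})$ an interpretation. $\mathcal{E}^\omega$ is the set of infinite traces; for $w\in\mathcal{E}^\omega$, $w_0$ is its first element and $w_{\geq1}$ the trace obtained by removing it. Terms of the Linear Time $\nu$-calculus (LT$\nu$) are inductively generated by $\mathsf{t},\mathsf{s}::=\top\mid\bot\mid p\mid p^\bot\mid\mathsf{t}\wedge\mathsf{s}\mid\mathsf{t}\vee\mathsf{s}\mid\circ\mathsf{t}\mid X\mid\nu X.\mathsf{t}$, with $p\in AP$ and $X$ a variable bound by $\nu X$. The relation $w\models_C\mathsf{t}$ is the coinductive interpretation (greatest relation, i.e. possibly infinite derivations) of the rules: $w\models_C\top$; $w\models_C p$ if $w_0\in\langle\!\langle p\rangle\!\rangle$; $w\models_C p^\bot$ if $w_0\notin\langle\!\langle p\rangle\!\rangle$; $w\models_C\circ\mathsf{t}$ from $w_{\geq1}\models_C\mathsf{t}$; $w\models_C\mathsf{t}\vee\mathsf{s}$ from $w\models_C\mathsf{t}$, or from $w\models_C\mathsf{s}$; $w\models_C\mathsf{t}\wedge\mathsf{s}$ from $w\models_C\mathsf{t}$ and $w\models_C\mathsf{s}$; $w\models_C\nu X.\mathsf{t}$ from $w\models_C\mathsf{t}\{\nu X.\mathsf{t}/X\}$ (capture-avoiding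 substitution). There is no rule for $\bot$ nor for a variable. Set $[\![\mathsf{t}]\!]=\{w\in\mathcal{E}^\omega\mid w\models_C\mathsf{t}\}$. A property $P\subseteq\mathcal{E}^\omega$ is a safety property if every $w\in\mathcal{E}^\omega\setminus P$ has a finite prefix $u$ such that no infinite trace with prefix $u$ belongs to $P$. -}

module Defs where

open import Data.Fin.Base using (Fin)
open import Data.Fin.Substitution using (Sub; Lift; TermSubst)
open import Data.List.Base using (List; length; applyUpTo)
open import Data.Nat.Base using (ℕ; zero; suc)
open import Data.Product.Base using (∃-syntax; Σ-syntax; _×_; _,_)
open import Data.Vec.Base using (lookup)
open import Function.Base using (_∘_)
open import Function.Bundles using (_↣_)
open import Level using (Level; 0ℓ)
import Level as L
open import Relation.Binary.Core using (REL; _⇒_)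
open import Relation.Binary.PropositionalEquality.Core using (_≡_)
open import Relation.Unary using (Pred; _∈_; _∉_)

private
  variable
    ℓ ℓ′ : Level
    m n : ℕ

-- Finite or countably infinite.
Countable : Set → Set
Countable A = A ↣ ℕ

Trace : Set → Set
Trace ℰ = ℕ → ℰ

_₀ : {ℰ : Set} → Trace ℰ → ℰ
w ₀ = w zero

_≥₁ : {ℰ : Set} → Trace ℰ → Trace ℰ
w ≥₁ = w ∘ suc

_IsPrefixOf_ : {ℰ : Set} → List ℰ → Trace ℰ → Set
u IsPrefixOf w = applyUpTo w (length u) ≡ u

Safety : {ℰ : Set} → Pred (Trace ℰ) ℓ → Set ℓ
Safety P = ∀ w → w ∉ P →
  ∃[ u ] u IsPrefixOf w × (∀ v → u IsPrefixOf v → v ∉ P)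

infixr 7 _∧_
infixr 6 _∨_
infix  8 ○_ ν_

-- Terms up to α-equivalence: variables are de Bruijn indices, and Term AP n
-- has its free variables among n; the closed terms are Term AP 0.
data Term (AP : Set) (n : ℕ) : Set where
  ⊤ ⊥     : Term AP n
  atom    : AP → Term AP n
  atom^⊥  : AP → Term AP n
  _∧_ _∨_ : Term AP n → Term AP n → Term AP n
  ○_      : Term AP n → Term AP n
  var     : Fin n → Term AP n
  ν_      : Term AP (suc n) → Term AP n

module TermApp {AP : Set} {T : ℕ → Set} (l : Lift T (Term AP)) where
  open Lift l using (lift; _↑)

  infixl 9 _/_

  _/_ : Term AP m → Sub T m n → Term AP n
  ⊤        / ρ = ⊤
  ⊥        / ρ = ⊥
  atom p   / ρ = atom p
  atom^⊥ p / ρ = atom^⊥ p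
  (t ∧ s)  / ρ = (t / ρ) ∧ (s / ρ)
  (t ∨ s)  / ρ = (t / ρ) ∨ (s / ρ)
  (○ t)    / ρ = ○ (t / ρ)
  var x    / ρ = lift (lookup ρ x)
  (ν t)    / ρ = ν (t / (ρ ↑))

termSubst : {AP : Set} → TermSubst (Term AP)
termSubst = record { var = var ; app = TermApp._/_ }

infix 9 _[_/0]

-- Substitution for the outermost variable, t{s/X}.
_[_/0] : {AP : Set} → Term AP (suc n) → Term AP n → Term AP n
t [ s /0] = t / sub s
  where open TermSubst termSubst using (_/_; sub)

module Semantics {ℰ AP : Set} (⟪_⟫ : AP → Pred ℰ 0ℓ) where

  -- Rules R w t: w ⊨ t is the conclusion of a rule whose premises lie in R.
  data Rules (R : REL (Trace ℰ) (Term AP n) ℓ) (w : Trace ℰ) : Term AP n → Set ℓ where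
    ⊤-rule      : Rules R w ⊤
    atom-rule   : ∀ {p} → w ₀ ∈ ⟪ p ⟫ → Rules R w (atom p)
    atom^⊥-rule : ∀ {p} → w ₀ ∉ ⟪ p ⟫ → Rules R w (atom^⊥ p)
    ○-rule      : ∀ {t} → R (w ≥₁) t → Rules R w (○ t)
    ∨-ruleˡ     : ∀ {t s} → R w t → Rules R w (t ∨ s)
    ∨-ruleʳ     : ∀ {t s} → R w s → Rules R w (t ∨ s)
    ∧-rule      : ∀ {t s} → R w t → R w s → Rules R w (t ∧ s)
    ν-rule      : ∀ {t} → R w (t [ ν t /0]) → Rules R w (ν t)

  infix 4 _⊨_

  -- The coinductive interpretation of the rules, as the union of all relations
  -- closed backwards under them. This avoids coinductive records, which need
  -- --guardedness.
  _⊨_ : REL (Trace ℰ) (Term AP n) (L.suc 0ℓ)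
  _⊨_ {n} w t = Σ[ R ∈ REL (Trace ℰ) (Term AP n) 0ℓ ] (R ⇒ Rules R) × R w t

  Rules-mono : {R : REL (Trace ℰ) (Term AP n) ℓ} {S : REL (Trace ℰ) (Term AP n) ℓ′} →
               R ⇒ S → Rules R ⇒ Rules S
  Rules-mono f ⊤-rule          = ⊤-rule
  Rules-mono f (atom-rule p)   = atom-rule p
  Rules-mono f (atom^⊥-rule p) = atom^⊥-rule p
  Rules-mono f (○-rule d)      = ○-rule (f d)
  Rules-mono f (∨-ruleˡ d)     = ∨-ruleˡ (f d)
  Rules-mono f (∨-ruleʳ d)     = ∨-ruleʳ (f d)
  Rules-mono f (∧-rule d e)    = ∧-rule (f d) (f e)
  Rules-mono f (ν-rule d)      = ν-rule (f d)

  ⊨-unfold : _⊨_ {n} ⇒ Rules _⊨_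
  ⊨-unfold (R , step , r) = Rules-mono (λ r′ → R , (λ {_} {_} → step) , r′) (step r)

  ⊨-greatest : {R : REL (Trace ℰ) (Term AP n) 0ℓ} → R ⇒ Rules R → R ⇒ _⊨_
  ⊨-greatest {R = R} step r = R , (λ {_} {_} → step) , r

  ⟦_⟧ : Term AP n → Pred (Trace ℰ) (L.suc 0ℓ)
  ⟦ t ⟧ w = w ⊨ t

{-# OPTIONS --safe #-}
-- Stratify ⊨ by derivation depth: w ⊨ t up to depth k depends only on the first
-- k letters of w. For a fixed w the derivation attempts branch finitely (a
-- disjunction offers two choices), so the intersection of the approximants is
-- already closed backwards under the rules, hence equals ⊨. A failure of w ⊨ t
-- thus occurs at some finite depth k, and the prefix of length k witnesses it.
module Submission where

open import Axiom.ExcludedMiddle using (ExcludedMiddle)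
open import Axiom.DoubleNegationElimination using (em⇒dne)
open import Data.List.Base using (applyUpTo)
open import Data.List.Properties using (∷-injectiveˡ; ∷-injectiveʳ; length-applyUpTo)
open import Data.Nat.Base using (ℕ; zero; suc; _+_; _≤_; _<_; z≤n; s≤s; z<s; s<s)
open import Data.Nat.Properties using (m≤m+n; m≤n+m; m<n⇒m<1+n)
open import Data.Product.Base using (∃-syntax; _,_)
import Data.Unit.Base as Unit
open import Function.Base using (_∘_; case_of_)
open import Level using (0ℓ)
open import Relation.Binary.Core using (REL; _⇒_)
open import Relation.Binary.PropositionalEquality using (_≡_; cong; subst; sym; trans)
open import Relation.Nullary using (¬_; yes; no; contradiction)
open import Relation.Unary using (Pred)
open import Defs

private
  variable
    A : Set
    n : ℕ

applyUpTo-≡⇒≡ : ∀ (f g : ℕ → A) k → applyUpTo f k ≡ applyUpTo g k →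
                ∀ {i} → i < k → f i ≡ g i
applyUpTo-≡⇒≡ f g (suc k) eq {zero}  z<s       = ∷-injectiveˡ eq
applyUpTo-≡⇒≡ f g (suc k) eq {suc i} (s<s i<k) =
  applyUpTo-≡⇒≡ (f ∘ suc) (g ∘ suc) k (∷-injectiveʳ eq) i<k

¬∀⇒∃¬ : ExcludedMiddle 0ℓ → {P : A → Set} → ¬ (∀ x → P x) → ∃[ x ] ¬ P x
¬∀⇒∃¬ em ¬∀ = em⇒dne em λ ¬∃ → ¬∀ λ x → em⇒dne em λ ¬p → ¬∃ (x , ¬p)

module _ {ℰ AP : Set} (⟪_⟫ : AP → Pred ℰ 0ℓ) where
  open Semantics ⟪_⟫

  infix 4 _⊨[_]_

  _⊨[_]_ : Trace ℰ → ℕ → Term AP n → Set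
  w ⊨[ zero ]  t = Unit.⊤
  w ⊨[ suc k ] t = Rules (_⊨[ k ]_) w t

  ⊨⇒⊨[] : ∀ k {w} {t : Term AP n} → w ⊨ t → w ⊨[ k ] t
  ⊨⇒⊨[] zero    d = Unit.tt
  ⊨⇒⊨[] (suc k) d = Rules-mono (⊨⇒⊨[] k) (⊨-unfold d)

  ⊨[]-antitone : ∀ {j k w} {t : Term AP n} → j ≤ k → w ⊨[ k ] t → w ⊨[ j ] t
  ⊨[]-antitone z≤n       d = Unit.tt
  ⊨[]-antitone (s≤s j≤k) d = Rules-mono (⊨[]-antitone j≤k) d

  -- A rule inspects at most the first letter, and only `○-rule` advances the trace. Each rule uses
  -- up one unit of depth, so `k` letters suffice.
  ⊨[]-resp-prefix : ∀ k {v w} {t : Term AP n} → (∀ {i} → i < k → v i ≡ w i) →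
                    v ⊨[ k ] t → w ⊨[ k ] t
  ⊨[]-resp-prefix zero    eq d = Unit.tt
  ⊨[]-resp-prefix (suc k) {v} {w} eq = go
    where
    same : {t : Term AP n} → v ⊨[ k ] t → w ⊨[ k ] t
    same = ⊨[]-resp-prefix k (eq ∘ m<n⇒m<1+n)

    go : {t : Term AP n} → v ⊨[ suc k ] t → w ⊨[ suc k ] t
    go ⊤-rule                  = ⊤-rule
    go (atom-rule {p} v₀∈p)    = atom-rule (subst ⟪ p ⟫ (eq z<s) v₀∈p)
    go (atom^⊥-rule {p} v₀∉p)  = atom^⊥-rule (v₀∉p ∘ subst ⟪ p ⟫ (sym (eq z<s)))
    go (○-rule d)              = ○-rule (⊨[]-resp-prefix k (eq ∘ s<s) d)
    go (∨-ruleˡ d)             = ∨-ruleˡ (same d)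
    go (∨-ruleʳ d)             = ∨-ruleʳ (same d)
    go (∧-rule d e)            = ∧-rule (same d) (same e)
    go (ν-rule d)              = ν-rule (same d)

  infix 4 _⊨ω_

  -- Being at level `0ℓ`, unlike `_⊨_`, this relation can itself serve as the witness `R` in `_⊨_`
  -- and be decided by `em`.
  _⊨ω_ : REL (Trace ℰ) (Term AP n) 0ℓ
  w ⊨ω t = ∀ k → w ⊨[ k ] t

  -- If t fails at depth k, then by antitonicity the derivations of t ∨ s at
  -- depth at least k + 1 all choose s.
  ⊨ω-∨ʳ : ∀ {k w} {t s : Term AP n} → ¬ w ⊨[ k ] t → w ⊨ω t ∨ s → w ⊨ω s
  ⊨ω-∨ʳ {k = k} ¬t d j with d (suc (k + j))
  ... | ∨-ruleˡ e = contradiction (⊨[]-antitone (m≤m+n k j) e) ¬t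
  ... | ∨-ruleʳ e = ⊨[]-antitone (m≤n+m j k) e

  module _ (em : ExcludedMiddle 0ℓ) where

    -- Apart from `_∨_`, a term is the conclusion of at most one rule, so inverting at every depth
    -- `suc k` yields the premises at every `k`. No induction on the term is involved: `ν t` is
    -- unfolded just once.
    ⊨ω-unfold : _⊨ω_ {n} ⇒ Rules _⊨ω_
    ⊨ω-unfold {n} {w} {t} = go t
      where
      go : (t : Term AP n) → w ⊨ω t → Rules _⊨ω_ w t
      go ⊤ d = ⊤-rule
      -- Depth 0 holds vacuously; 1 is the first depth that demands a rule.
      go ⊥ d with () ← d 1
      go (atom p) d with atom-rule w₀∈p ← d 1 = atom-rule w₀∈p
      go (atom^⊥ p) d with atom^⊥-rule w₀∉p ← d 1 = atom^⊥-rule w₀∉p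
      go (t ∧ s) d = ∧-rule
        (λ k → case d (suc k) of λ { (∧-rule e _) → e })
        (λ k → case d (suc k) of λ { (∧-rule _ e) → e })
      -- The disjunct used may vary with the depth; one that works at all depths is selected
      -- classically.
      go (t ∨ s) d with em {w ⊨ω t}
      ... | yes dₜ = ∨-ruleˡ dₜ
      ... | no ¬dₜ with k , ¬t ← ¬∀⇒∃¬ em ¬dₜ = ∨-ruleʳ (⊨ω-∨ʳ {k = k} ¬t d)
      go (○ t) d = ○-rule λ k → case d (suc k) of λ { (○-rule e) → e }
      go (var x) d with () ← d 1
      go (ν t) d = ν-rule λ k → case d (suc k) of λ { (ν-rule e) → e }

proposition8 : ExcludedMiddle 0ℓ →
    (ℰ AP : Set) → Countable AP → (⟪_⟫ : AP → Pred ℰ 0ℓ) →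
    ∀ {n} (t : Term AP n) → Safety (Semantics.⟦_⟧ ⟪_⟫ t)
proposition8 em ℰ AP _ ⟪_⟫ t w w⊭t
  -- By coinduction `_⊨ω_` is contained in `_⊨_`, so `w⊭t` makes some finite depth `k` fail.
  with k , ¬t ← ¬∀⇒∃¬ em (w⊭t ∘ Semantics.⊨-greatest ⟪_⟫ (⊨ω-unfold ⟪_⟫ em))
  = applyUpTo w k
  , cong (applyUpTo w) (length-applyUpTo w k)
  , λ v u⊑v v⊨t → ¬t (⊨[]-resp-prefix ⟪_⟫ k
      (applyUpTo-≡⇒≡ v w k (trans (cong (applyUpTo v) (sym (length-applyUpTo w k))) u⊑v))
      (⊨⇒⊨[] ⟪_⟫ k v⊨t))
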